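{- Let $U$ be an infinite set with $|U| = \kappa$, $\aleph_0 \leq \kappa$. Then for every $S \subseteq U$ such that $|S| < |U|$ there exists an injective function $\star_S : U^2 \to U$ such that for every sequence $s \in \mathsf{Sec}$, $\left|\mathit{fix}_s(\star_S)\right| = |S|$.
   Context: Sequences: $\mathsf{Sec}$ is the smallest set of terms generated by the grammar $\mathsf{sec} ::= \mathtt{elem}\ * \mid \mathtt{cons}\ *\ \mathsf{sec}$, where $* \in \{\pi, \rho\}$ (nonempty finite sequences of the two symbols $\pi,\rho$). For $\star : U^2 \to U$ and binary relations $r, s$ on $U$, put $r \mathbin{\underline{\nabla}} s = \{\langle a, x \star y\rangle \mid \langle a,x\rangle \in r,\ \langle a,y\rangle \in s\}$. Let $\mathit{Id}$ be the identity relation on $U$ and $E = U \times U$; let $\breve{r}$ denote the converse of $r$ and $\circ$ relational composition, $x\circ y=\{\langle a,b\rangle\mid \exists c\,(\langle a,c\rangle\in x\wedge\langle c,b\rangle\in y)\}$. Define $\underline{\pi}$ as the converse of $\mathit{Id} \mathbin{\underline{\nabla}} E$ (so $\underline{\pi} = \{\langle u \star v, u\rangle \mid u,v \in U\}$) and $\underline{\rho}$ as the converse of $E \mathbin{\underline{\nabla}} \mathit{Id}$ (so $\underline{\rho} = \{\langle u \star v, v\rangle \mid u,v \in U\}$). For $s \in \mathsf{Sec}$ define the relation $\underline{s}$ by $\underline{\mathtt{elem}\ *} = \underline{*}$ and $\underline{\mathtt{cons}\ *\ s} = \underline{*} \circ \underline{s}$. The $s$-controlled fixpoints of $\star$ are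 $\mathit{fix}_s(\star) = \{u \in U \mid \langle u,u\rangle \in \underline{s}\}$. -}

module Defs where

open import Data.Nat.Base using (ℕ)
open import Data.Product.Base using (Σ; _×_; _,_; proj₁; ∃₂)
open import Function.Base using (flip)
open import Function.Bundles using (Injection; Bijection)
open import Level using (Level; _⊔_)
open import Relation.Binary.Bundles using (Setoid)
open import Relation.Binary.Construct.Always using (Always)
open import Relation.Binary.Construct.Composition using (_;_)
import Relation.Binary.Construct.On as On
open import Relation.Binary.Core using (Rel)
open import Relation.Binary.PropositionalEquality using (_≡_; setoid)
open import Relation.Nullary.Negation.Core using (¬_)
open import Relation.Unary using (Pred)

private
  variable
    a b ℓ p : Level

infix 4 _≤ᶜ_ _≈ᶜ_ _<ᶜ_

_≤ᶜ_ : Setoid a ℓ → Setoid b p → Set (a ⊔ ℓ ⊔ b ⊔ p)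
A ≤ᶜ B = Injection A B

_≈ᶜ_ : Setoid a ℓ → Setoid b p → Set (a ⊔ ℓ ⊔ b ⊔ p)
A ≈ᶜ B = Bijection A B

_<ᶜ_ : Setoid a ℓ → Setoid b p → Set (a ⊔ ℓ ⊔ b ⊔ p)
A <ᶜ B = A ≤ᶜ B × ¬ (A ≈ᶜ B)

Infinite : Set a → Set a
Infinite U = setoid ℕ ≤ᶜ setoid U

-- Elements are compared by first component only, so that different proofs of
-- membership of the same u : U are not counted as different elements.
subset : {U : Set a} → Pred U p → Setoid (a ⊔ p) a
subset {U = U} P = On.setoid {B = Σ U P} (setoid U) proj₁

data Symbol : Set where
  π ρ : Symbol

data Sec : Set where
  elem : Symbol → Sec
  cons : Symbol → Sec → Sec

module _ {U : Set ℓ} (⋆ : U × U → U) where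

  fork : Rel U ℓ → Rel U ℓ → Rel U ℓ
  fork r s a b = ∃₂ λ x y → b ≡ ⋆ (x , y) × r a x × s a y

  sym⟦_⟧ : Symbol → Rel U ℓ
  sym⟦ π ⟧ = flip (fork _≡_ Always)
  sym⟦ ρ ⟧ = flip (fork Always _≡_)

  ⟦_⟧ : Sec → Rel U ℓ
  ⟦ elem x ⟧   = sym⟦ x ⟧
  ⟦ cons x s ⟧ = sym⟦ x ⟧ ; ⟦ s ⟧

  fix : Sec → Pred U ℓ
  fix s u = ⟦ s ⟧ u u

{-# OPTIONS --safe #-}
-- Excluded middle for arbitrary types is a choice operator, so Zorn's lemma, the comparability of
-- cardinals and Hessenberg's theorem |U × U| ≤ |U| are available.  From an injection U × U ↣ U
-- and ℕ ↣ U one gets injections φ : U ↣ U and j : ℕ × U × U ↣ U with disjoint images.  Give j (n , x , y)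
-- level n + 1 and everything else level 0.  Let ⋆ (x , x) = x for x ∈ φ(S), and otherwise let
-- ⋆ (x , y) = j (max (level x) (level y) , x , y), whose level exceeds those of x and y.  The elements
-- of φ(S) are then fixpoints of every sequence, while both projections strictly decrease the level of
-- every other element of the image of ⋆, so there are no further fixpoints.
module Submission where

open import Defs
open import Axiom.ExcludedMiddle using (ExcludedMiddle)
open import Axiom.Extensionality.Propositional using (Extensionality; lower-extensionality)
open import Data.Bool.Base using (Bool; true; false; T)
open import Data.Bool.Properties using (T-irrelevant)
open import Data.Empty using (⊥-elim)
open import Data.Nat.Base using (ℕ; suc; _+_; _*_; _⊔_; _≤_; _<_; s≤s)
open import Data.Nat.Properties
  using (<-cmp; <-irrefl; <-≤-trans; <⇒≤; ≤-refl; ≤-reflexive; suc-injective; m≤m+n; m≤n+m; m≤m⊔n; m≤n⊔m;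
         +-cancelˡ-≡; *-mono-≤; +-monoʳ-≤; +-comm; module ≤-Reasoning)
open import Data.Product.Base using (Σ; ∃; Σ-syntax; ∃-syntax; ∃₂; _×_; _,_; proj₁; proj₂; swap)
open import Data.Product.Function.NonDependent.Propositional using (_×-↣_)
open import Data.Product.Properties using (,-injectiveˡ; ,-injectiveʳ)
open import Data.Sum.Base using (_⊎_; inj₁; inj₂; [_,_]′)
open import Data.Sum.Function.Propositional using (_⊎-↣_)
open import Data.Sum.Properties using (inj₁-injective; inj₂-injective)
open import Function.Base using (_∘_; id; case_of_)
open import Function.Bundles using (Injection; _↣_; mk↣)
open import Function.Construct.Composition using (_↣-∘_)
open import Function.Construct.Identity using (↣-id)
open import Function.Definitions using (Injective)
open import Level using (Level; Lift; lift; lower)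
open import Relation.Binary.Definitions using (tri<; tri≈; tri>)
open import Relation.Binary.PropositionalEquality
  using (_≡_; _≢_; refl; sym; trans; cong; cong₂; subst; setoid)
open import Relation.Nullary.Decidable.Core using (Dec; yes; no; ⌊_⌋; toWitness; fromWitness; decidable-stable)
open import Relation.Nullary.Negation.Core using (¬_; contradiction)
open import Relation.Unary using (Pred)

open Injection using (to; injective)

private
  variable
    a b : Level
    A X : Set a

-- Boolean-valued subsets.

infix 4 _∈_ _⊆_

-- Subsets are Bool-valued so that families of subsets of X live in the universe of X.
Subset : Set a → Set a
Subset X = X → Bool

-- A record rather than `T (P x)` itself, so that `x` and `P` can be recovered from the type by
-- unification.
record _∈_ {X : Set a} (x : X) (P : Subset X) : Set where
  constructor mem
  field holds : T (P x)

_⊆_ : {X : Set a} → Subset X → Subset X → Set a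
P ⊆ Q = ∀ {x} → x ∈ P → x ∈ Q

Carrier : {X : Set a} → Subset X → Set a
Carrier {X = X} P = Σ[ x ∈ X ] x ∈ P

Carrier-↣ : (P : Subset X) → Carrier P ↣ X
Carrier-↣ P = mk↣ {to = proj₁} λ { {x , mem p} {.x , mem q} refl → cong (λ r → x , mem r) (T-irrelevant p q) }

-- Injective coding of pairs.

-- The next square after `n * n` is larger by `2n + 1`, which exceeds any remainder `m ≤ n`.
square+-< : ∀ {m n} → m ≤ n → ∀ {k l} → n < k → n * n + m < k * k + l
square+-< {m} {n} m≤n {k} {l} n<k = begin-strict
  n * n + m           ≤⟨ +-monoʳ-≤ (n * n) m≤n ⟩
  n * n + n           ≡⟨ +-comm (n * n) n ⟩
  n + n * n           <⟨ s≤s (+-monoʳ-≤ n (*-mono-≤ (≤-refl {n}) (m≤n+m n 1))) ⟩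
  suc n + n * suc n   ≤⟨ *-mono-≤ n<k n<k ⟩
  k * k               ≤⟨ m≤m+n (k * k) l ⟩
  k * k + l           ∎
  where open ≤-Reasoning

-- (m , n) ↦ (m + n)² + m: the squares determine m + n, since m ≤ m + n.
ℕ×ℕ↣ℕ : (ℕ × ℕ) ↣ ℕ
ℕ×ℕ↣ℕ = mk↣ {to = code} inj
  where
  code : ℕ × ℕ → ℕ
  code (m , n) = (m + n) * (m + n) + m
  inj : Injective _≡_ _≡_ code
  inj {m , n} {m′ , n′} eq with <-cmp (m + n) (m′ + n′)
  ... | tri< lt _ _ = contradiction (square+-< (m≤m+n m n) lt) (<-irrefl eq)
  ... | tri> _ _ gt = contradiction (square+-< (m≤m+n m′ n′) gt) (<-irrefl (sym eq))
  ... | tri≈ _ e _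
    with refl ← +-cancelˡ-≡ ((m + n) * (m + n)) m m′ (trans eq (cong (λ k → k * k + m′) (sym e)))
    = cong (m ,_) (+-cancelˡ-≡ m n n′ e)

-- The two distinct elements serve as tags; followed by a pairing this embeds `A ⊎ A` in `A`.
⊎↣× : {x₀ x₁ : A} → x₀ ≢ x₁ → (A ⊎ A) ↣ (A × A)
⊎↣× {A = A} {x₀} {x₁} x₀≢x₁ = mk↣ {to = tag} inj
  where
  tag : A ⊎ A → A × A
  tag = [ x₀ ,_ , x₁ ,_ ]′
  inj : Injective _≡_ _≡_ tag
  inj {inj₁ _} {inj₁ _} eq = cong inj₁ (,-injectiveʳ eq)
  inj {inj₁ _} {inj₂ _} eq = contradiction (,-injectiveˡ eq) x₀≢x₁
  inj {inj₂ _} {inj₁ _} eq = contradiction (sym (,-injectiveˡ eq)) x₀≢x₁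
  inj {inj₂ _} {inj₂ _} eq = cong inj₂ (,-injectiveʳ eq)

-- Pairs involving a new element (right summand) are coded by new elements, so p is preserved.
module Doubling {A : Set a} (p : (A × A) ↣ A) (d : (A ⊎ A) ↣ A) where

  recode : (A ⊎ A) × (A ⊎ A) → A
  recode (u , v) = to p (to d u , to d v)

  recode-injective : Injective _≡_ _≡_ recode
  recode-injective eq = injective (d ×-↣ d) (injective p eq)

  double : (A ⊎ A) × (A ⊎ A) → A ⊎ A
  double (inj₁ x , inj₁ y)     = inj₁ (to p (x , y))
  double w@(inj₁ _ , inj₂ _)   = inj₂ (recode w)
  double w@(inj₂ _ , _)        = inj₂ (recode w)

  double-injective : Injective _≡_ _≡_ double
  double-injective {inj₁ _ , inj₁ _} {inj₁ _ , inj₁ _} eq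
    with refl ← injective p (inj₁-injective eq) = refl
  double-injective {inj₁ _ , inj₂ _} {inj₁ _ , inj₂ _} eq = recode-injective (inj₂-injective eq)
  double-injective {inj₁ _ , inj₂ _} {inj₂ _ , _}      eq = recode-injective (inj₂-injective eq)
  double-injective {inj₂ _ , _}      {inj₁ _ , inj₂ _} eq = recode-injective (inj₂-injective eq)
  double-injective {inj₂ _ , _}      {inj₂ _ , _}      eq = recode-injective (inj₂-injective eq)

  doubled : ((A ⊎ A) × (A ⊎ A)) ↣ (A ⊎ A)
  doubled = mk↣ {to = double} double-injective

-- Partial injections as relations.

record PartialInjection {A : Set a} {B : Set b} (R : Subset (A × B)) : Set (a Level.⊔ b) where
  field
    functional   : ∀ {x y y′} → (x , y) ∈ R → (x , y′) ∈ R → y ≡ y′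
    cofunctional : ∀ {x x′ y} → (x , y) ∈ R → (x′ , y) ∈ R → x ≡ x′

module _ {A : Set a} {B : Set b} {R : Subset (A × B)} where

  total⇒↣ : (∀ {x y x′} → (x , y) ∈ R → (x′ , y) ∈ R → x ≡ x′) →
            (∀ x → ∃[ y ] (x , y) ∈ R) → A ↣ B
  total⇒↣ inj f = mk↣ {to = proj₁ ∘ f} λ {x} {x′} eq →
    inj (subst (λ y → (x , y) ∈ R) eq (proj₂ (f x))) (proj₂ (f x′))

-- Classical subsets, unions and chains.

module Classical {ℓ} (em : ExcludedMiddle ℓ) (ext : Extensionality ℓ ℓ) where

  ⟪_⟫ : {X : Set ℓ} → (X → Set ℓ) → Subset X
  ⟪ P ⟫ x = ⌊ em {P x} ⌋

  ∈⟪⟫⁺ : {X : Set ℓ} {P : X → Set ℓ} {x : X} → P x → x ∈ ⟪ P ⟫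
  ∈⟪⟫⁺ p = mem (fromWitness p)

  ∈⟪⟫⁻ : {X : Set ℓ} {P : X → Set ℓ} {x : X} → x ∈ ⟪ P ⟫ → P x
  ∈⟪⟫⁻ (mem p) = toWitness p

  ⊆-antisym : {X : Set ℓ} {P Q : Subset X} → P ⊆ Q → Q ⊆ P → P ≡ Q
  ⊆-antisym {P = P} {Q} P⊆Q Q⊆P = lower-extensionality ℓ ℓ ext λ x →
    T-ext (_∈_.holds ∘ P⊆Q {x} ∘ mem) (_∈_.holds ∘ Q⊆P {x} ∘ mem)
    where
    T-ext : ∀ {p q} → (T p → T q) → (T q → T p) → p ≡ q
    T-ext {true}  {true}  _ _ = refl
    T-ext {true}  {false} f _ = ⊥-elim (f _)
    T-ext {false} {true}  _ g = ⊥-elim (g _)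
    T-ext {false} {false} _ _ = refl

  ⋃ : {X : Set ℓ} → Subset (Subset X) → Subset X
  ⋃ F = ⟪ (λ x → ∃[ P ] P ∈ F × x ∈ P) ⟫

  ⊆-⋃ : {X : Set ℓ} {F : Subset (Subset X)} {P : Subset X} → P ∈ F → P ⊆ ⋃ F
  ⊆-⋃ P∈F x∈P = ∈⟪⟫⁺ (_ , P∈F , x∈P)

  ⋃-⊆ : {X : Set ℓ} {F : Subset (Subset X)} {Q : Subset X} → (∀ {P} → P ∈ F → P ⊆ Q) → ⋃ F ⊆ Q
  ⋃-⊆ h x∈⋃ with _ , P∈F , x∈P ← ∈⟪⟫⁻ x∈⋃ = h P∈F x∈P

  Chain : {X : Set ℓ} → Subset (Subset X) → Set ℓ
  Chain F = ∀ {P Q} → P ∈ F → Q ∈ F → P ⊆ Q ⊎ Q ⊆ P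

  -- Zorn's lemma.

  -- Bourbaki–Witt: the closure of base under next and unions is a chain, so its union is fixed by next.
  module Zorn {X : Set ℓ} (Good : Subset X → Set ℓ) where

    Extension : Subset X → Set ℓ
    Extension P = ∃[ Q ] Good Q × P ⊆ Q × ¬ Q ⊆ P

    -- A positive decision carries its witness, so `em` selects one proper good extension for each
    -- `P`.
    step : ∀ P → Dec (Extension P) → Subset X
    step _ (yes (Q , _)) = Q
    step P (no _)        = P

    next : Subset X → Subset X
    next P = step P em

    next-⊇ : ∀ {P} → P ⊆ next P
    next-⊇ {P} x∈P with em {Extension P}
    ... | yes (_ , _ , P⊆Q , _) = P⊆Q x∈P
    ... | no _                  = x∈P

    next-good : ∀ {P} → Good P → Good (next P)
    next-good {P} good with em {Extension P}
    ... | yes (_ , good′ , _) = good′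
    ... | no _                = good

    next-fixed⇒maximal : ∀ {P} → next P ⊆ P → ∀ {Q} → Good Q → P ⊆ Q → Q ⊆ P
    next-fixed⇒maximal {P} fixed {Q} good P⊆Q with em {Extension P}
    ... | yes (_ , _ , _ , ⊈P) = ⊥-elim (⊈P fixed)
    ... | no none = decidable-stable em λ Q⊈P → none (Q , good , P⊆Q , Q⊈P)

    module _ {base : Subset X} where

      -- The family in `sup` is inhabited so that its union still contains `base`. That such
      -- families are chains follows from `tower-chain`.
      data Tower : Subset X → Set ℓ where
        bot : Tower base
        nxt : ∀ {P} → Tower P → Tower (next P)
        sup : ∀ {F} → ∃ (_∈ F) → (∀ {P} → P ∈ F → Tower P) → Tower (⋃ F)

      base-⊆ : ∀ {P} → Tower P → base ⊆ P
      base-⊆ bot                x∈ = x∈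
      base-⊆ (nxt t)            x∈ = next-⊇ (base-⊆ t x∈)
      base-⊆ (sup (_ , P∈F) ts) x∈ = ⊆-⋃ P∈F (base-⊆ (ts P∈F) x∈)

      -- These are the extreme points of the usual Bourbaki-Witt proof.
      Gap : Subset X → Set ℓ
      Gap P = ∀ {Q} → Tower Q → Q ⊆ P → P ≡ Q ⊎ next Q ⊆ P

      -- Induction on the tower derivation of `Q`: while `Q` is inside `P`, the gap forces its
      -- successor to stay inside `P` or to be `next P`.
      gap⇒comparable : ∀ {P} → Tower P → Gap P → ∀ {Q} → Tower Q → next P ⊆ Q ⊎ Q ⊆ P
      gap⇒comparable p gap bot = inj₂ (base-⊆ p)
      gap⇒comparable {P} p gap (nxt {Q} q) with gap⇒comparable p gap q
      ... | inj₁ nP⊆Q = inj₁ λ {x} x∈ → next-⊇ (nP⊆Q x∈)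
      ... | inj₂ Q⊆P with gap q Q⊆P
      ...   | inj₁ refl = inj₁ id
      ...   | inj₂ nQ⊆P = inj₂ nQ⊆P
      gap⇒comparable {P} p gap (sup {F} _ qs) with em {∃[ Q ] Q ∈ F × next P ⊆ Q}
      ... | yes (_ , Q∈F , nP⊆Q) = inj₁ λ {x} x∈ → ⊆-⋃ Q∈F (nP⊆Q x∈)
      ... | no none = inj₂ (⋃-⊆ λ {Q} Q∈F →
        [ (λ nP⊆Q → contradiction (Q , Q∈F , λ {x} → nP⊆Q {x}) none) , (λ Q⊆P → Q⊆P) ]′
        (gap⇒comparable p gap (qs Q∈F)))

      tower-gap : ∀ {P} → Tower P → Gap P
      tower-gap bot q Q⊆P = inj₁ (⊆-antisym (base-⊆ q) Q⊆P)
      tower-gap (nxt p) q Q⊆nP with gap⇒comparable p (tower-gap p) q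
      ... | inj₁ nP⊆Q = inj₁ (⊆-antisym nP⊆Q Q⊆nP)
      ... | inj₂ Q⊆P with tower-gap p q Q⊆P
      ...   | inj₁ refl = inj₂ id
      ...   | inj₂ nQ⊆P = inj₂ λ {x} x∈ → next-⊇ (nQ⊆P x∈)
      -- If every member lies in `Q`, the union equals `Q`. Otherwise a member `P` outside `Q`
      -- contains `Q` properly, and its own gap puts `next Q` inside `P`.
      tower-gap (sup {F} _ ps) {Q} q Q⊆⋃ with em {∃[ P ] P ∈ F × ¬ P ⊆ Q}
      ... | no none = inj₁ (⊆-antisym
        (⋃-⊆ λ {P} P∈F → decidable-stable em λ P⊈Q → none (P , P∈F , P⊈Q)) Q⊆⋃)
      ... | yes (P , P∈F , P⊈Q) with gap⇒comparable (ps P∈F) (tower-gap (ps P∈F)) q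
      ...   | inj₁ nP⊆Q = ⊥-elim (P⊈Q λ x∈ → nP⊆Q (next-⊇ x∈))
      ...   | inj₂ Q⊆P with tower-gap (ps P∈F) q Q⊆P
      ...     | inj₁ refl = ⊥-elim (P⊈Q id)
      ...     | inj₂ nQ⊆P = inj₂ λ {x} x∈ → ⊆-⋃ P∈F (nQ⊆P x∈)

      tower-chain : ∀ {P Q} → Tower P → Tower Q → P ⊆ Q ⊎ Q ⊆ P
      tower-chain p q with gap⇒comparable p (tower-gap p) q
      ... | inj₁ nP⊆Q = inj₁ λ {x} x∈ → nP⊆Q (next-⊇ x∈)
      ... | inj₂ Q⊆P  = inj₂ Q⊆P

    zorn : (∀ {F} → Chain F → (∀ {P} → P ∈ F → Good P) → Good (⋃ F)) →
           ∀ {base} → Good base →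
           ∃[ M ] Good M × base ⊆ M × (∀ {Q} → Good Q → M ⊆ Q → Q ⊆ M)
    -- `M` is the union of the whole tower and belongs to it, so `next M` is one of the sets united
    -- and lies in `M`.
    zorn ⋃-good {base} base-good = M , tower-good M∈ , base-⊆ M∈ , next-fixed⇒maximal (⊆-⋃ (∈⟪⟫⁺ (nxt M∈)))
      where
      tower-good : ∀ {P} → Tower {base} P → Good P
      tower-good bot        = base-good
      tower-good (nxt t)    = next-good (tower-good t)
      tower-good (sup _ ts) =
        ⋃-good (λ P∈ Q∈ → tower-chain (ts P∈) (ts Q∈)) (λ P∈ → tower-good (ts P∈))
      M : Subset X
      M = ⋃ ⟪ Tower {base} ⟫
      M∈ : Tower {base} M
      M∈ = sup (base , ∈⟪⟫⁺ bot) ∈⟪⟫⁻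

  -- Comparability of cardinals.

  -- The larger of two members of the chain serves. Conditions on two elements thus pass from the
  -- members to the union.
  chain-common : {X : Set ℓ} {F : Subset (Subset X)} → Chain F → ∀ {x y} → x ∈ ⋃ F → y ∈ ⋃ F →
                 ∃[ P ] P ∈ F × x ∈ P × y ∈ P
  chain-common chain x∈ y∈
    with P , P∈ , x∈P ← ∈⟪⟫⁻ x∈ | Q , Q∈ , y∈Q ← ∈⟪⟫⁻ y∈
    with chain P∈ Q∈
  ... | inj₁ P⊆Q = Q , Q∈ , P⊆Q x∈P , y∈Q
  ... | inj₂ Q⊆P = P , P∈ , x∈P , Q⊆P y∈Q

  ⋃-partialInjection : {A B : Set ℓ} {F : Subset (Subset (A × B))} → Chain F →
                       (∀ {R} → R ∈ F → PartialInjection R) → PartialInjection (⋃ F)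
  ⋃-partialInjection chain good = record
    { functional   = λ p q → let _ , R∈ , p′ , q′ = chain-common chain p q in
                   PartialInjection.functional (good R∈) p′ q′
    ; cofunctional = λ p q → let _ , R∈ , p′ , q′ = chain-common chain p q in
                   PartialInjection.cofunctional (good R∈) p′ q′
    }

  -- A maximal partial injection is total or onto: otherwise an unmatched `x₀` and an unmatched `y₀`
  -- could be joined to it.
  ↣-total : (A B : Set ℓ) → (A ↣ B) ⊎ (B ↣ A)
  ↣-total A B
    -- The starting relation is the union of the empty family, so its conditions hold vacuously.
    with zorn ⋃-partialInjection {⋃ (λ _ → false)} (⋃-partialInjection (λ { (mem ()) }) λ { (mem ()) })
    where open Zorn {A × B} PartialInjection
  ... | M , good , _ , maximal with em {∃[ x ] ¬ (∃[ y ] (x , y) ∈ M)} | em {∃[ y ] ¬ (∃[ x ] (x , y) ∈ M)}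
  ... | no none | _ = inj₁ (total⇒↣ (PartialInjection.cofunctional good)
                              λ x → decidable-stable em λ ∄ → none (x , ∄))
  ... | yes _ | no none = inj₂ (total⇒↣ {R = M ∘ swap}
                              (λ { (mem p) (mem q) → PartialInjection.functional good (mem p) (mem q) })
                              λ y → case decidable-stable em (λ ∄ → none (y , ∄)) of
                                λ { (x , mem p) → x , mem p })
  ... | yes (x₀ , x₀∉) | yes (y₀ , y₀∉) =
    contradiction (y₀ , maximal good⁺ (λ p → ∈⟪⟫⁺ (inj₁ (lift p))) (∈⟪⟫⁺ (inj₂ refl))) x₀∉
    where
    M⁺ : A × B → Set ℓ
    M⁺ w = Lift ℓ (w ∈ M) ⊎ w ≡ (x₀ , y₀)
    fun : ∀ {x y y′} → M⁺ (x , y) → M⁺ (x , y′) → y ≡ y′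
    fun (inj₁ (lift p)) (inj₁ (lift q)) = PartialInjection.functional good p q
    fun (inj₁ (lift p)) (inj₂ refl)     = contradiction (_ , p) x₀∉
    fun (inj₂ refl)     (inj₁ (lift q)) = contradiction (_ , q) x₀∉
    fun (inj₂ refl)     (inj₂ refl)     = refl
    inj : ∀ {x x′ y} → M⁺ (x , y) → M⁺ (x′ , y) → x ≡ x′
    inj (inj₁ (lift p)) (inj₁ (lift q)) = PartialInjection.cofunctional good p q
    inj (inj₁ (lift p)) (inj₂ refl)     = contradiction (_ , p) y₀∉
    inj (inj₂ refl)     (inj₁ (lift q)) = contradiction (_ , q) y₀∉
    inj (inj₂ refl)     (inj₂ refl)     = refl
    good⁺ : PartialInjection ⟪ M⁺ ⟫
    good⁺ = record
      { functional   = λ p q → fun (∈⟪⟫⁻ p) (∈⟪⟫⁻ q)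
      ; cofunctional = λ p q → inj (∈⟪⟫⁻ p) (∈⟪⟫⁻ q)
      }

  -- Hessenberg's theorem.

  module _ {U : Set ℓ} where

    -- The underlying set is read off the diagonal, so a relation alone records both a set and its
    -- pairing, and Zorn's lemma applies to relations under inclusion.
    Field : Subset ((U × U) × U) → U → Set ℓ
    Field R x = ∃[ z ] ((x , x) , z) ∈ R

    -- The graph of an injection from Field R × Field R to Field R.
    record Pairing (R : Subset ((U × U) × U)) : Set ℓ where
      field
        partialInjection : PartialInjection R
        closed : ∀ {x y z} → ((x , y) , z) ∈ R → Field R x × Field R y × Field R z
        total  : ∀ {x y} → Field R x → Field R y → ∃[ z ] ((x , y) , z) ∈ R
      open PartialInjection partialInjection public

      pair : (Carrier ⟪ Field R ⟫ × Carrier ⟪ Field R ⟫) ↣ Carrier ⟪ Field R ⟫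
      pair = mk↣ {to = code} λ {v} {w} eq → inj {v} {w} (cong proj₁ eq)
        where
        entry : ∀ w → ∃[ z ] ((proj₁ (proj₁ w) , proj₁ (proj₂ w)) , z) ∈ R
        entry ((_ , x∈) , (_ , y∈)) = total (∈⟪⟫⁻ x∈) (∈⟪⟫⁻ y∈)
        code : Carrier ⟪ Field R ⟫ × Carrier ⟪ Field R ⟫ → Carrier ⟪ Field R ⟫
        code w = proj₁ (entry w) , ∈⟪⟫⁺ (proj₂ (proj₂ (closed (proj₂ (entry w)))))
        inj : ∀ {v w} → proj₁ (entry v) ≡ proj₁ (entry w) → v ≡ w
        inj {v} {w} eq = injective (Carrier-↣ ⟪ Field R ⟫ ×-↣ Carrier-↣ ⟪ Field R ⟫)
          (cofunctional (subst (λ z → (_ , z) ∈ R) eq (proj₂ (entry v))) (proj₂ (entry w)))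

      pair-∈ : ∀ v w → ((proj₁ v , proj₁ w) , proj₁ (to pair (v , w))) ∈ R
      pair-∈ (_ , x∈) (_ , y∈) = proj₂ (total (∈⟪⟫⁻ x∈) (∈⟪⟫⁻ y∈))

    Field-mono : ∀ {Q R} → Q ⊆ R → ∀ {x} → Field Q x → Field R x
    Field-mono Q⊆R (z , p) = z , Q⊆R p

    ⋃-pairing : {F : Subset (Subset ((U × U) × U))} → Chain F → (∀ {R} → R ∈ F → Pairing R) → Pairing (⋃ F)
    ⋃-pairing {F} chain good = record
      { partialInjection = ⋃-partialInjection chain (Pairing.partialInjection ∘ good)
      ; closed = λ p → let R , R∈ , p′ = ∈⟪⟫⁻ p
                           x∈ , y∈ , z∈ = Pairing.closed (good R∈) p′
                       in Field-mono (⊆-⋃ R∈) x∈ , Field-mono (⊆-⋃ R∈) y∈ , Field-mono (⊆-⋃ R∈) z∈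
      ; total = λ { (x′ , p) (y′ , q) →
          let _ , R∈ , p′ , q′ = chain-common chain p q
              z , r = Pairing.total (good R∈) (x′ , p′) (y′ , q′)
          in z , ⊆-⋃ R∈ r }
      }

    module _ {B : Set ℓ} (e : B ↣ U) (q : (B × B) ↣ B) where

      -- The pairing `q` transported along `e`. It gives both the starting point for Zorn's lemma
      -- and the extension that contradicts maximality.
      Graph : (U × U) × U → Set ℓ
      Graph ((x , y) , z) = ∃₂ λ u v → x ≡ to e u × y ≡ to e v × z ≡ to e (to q (u , v))

      graph-∈ : ∀ u v → ((to e u , to e v) , to e (to q (u , v))) ∈ ⟪ Graph ⟫
      graph-∈ u v = ∈⟪⟫⁺ (u , v , refl , refl , refl)

      graph-field : ∀ u → Field ⟪ Graph ⟫ (to e u)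
      graph-field u = _ , graph-∈ u u

      graph-pairing : Pairing ⟪ Graph ⟫
      graph-pairing = record
        { partialInjection = record
          { functional   = λ r s → fun (∈⟪⟫⁻ r) (∈⟪⟫⁻ s)
          ; cofunctional = λ r s → inj (∈⟪⟫⁻ r) (∈⟪⟫⁻ s)
          }
        ; closed = λ r → clo (∈⟪⟫⁻ r)
        ; total  = λ r s → tot (∈⟪⟫⁻ (proj₂ r)) (∈⟪⟫⁻ (proj₂ s))
        }
        where
        fun : ∀ {w z z′} → Graph (w , z) → Graph (w , z′) → z ≡ z′
        fun (u , v , refl , refl , refl) (u′ , v′ , eu , ev , refl) =
          cong (to e ∘ to q) (cong₂ _,_ (injective e eu) (injective e ev))
        inj : ∀ {w w′ z} → Graph (w , z) → Graph (w′ , z) → w ≡ w′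
        inj (u , v , refl , refl , refl) (u′ , v′ , refl , refl , eq)
          with refl ← injective q (injective e eq) = refl
        clo : ∀ {x y z} → Graph ((x , y) , z) →
              Field ⟪ Graph ⟫ x × Field ⟪ Graph ⟫ y × Field ⟪ Graph ⟫ z
        clo (u , v , refl , refl , refl) = graph-field u , graph-field v , graph-field _
        tot : ∀ {x x′ y y′} → Graph ((x , x) , x′) → Graph ((y , y) , y′) → ∃[ z ] ((x , y) , z) ∈ ⟪ Graph ⟫
        tot (u , _ , refl , _) (v , _ , refl , _) = _ , graph-∈ u v

    -- If the complement of the field A embeds in A, then U embeds in A ⊎ A, hence in A;
    -- otherwise A embeds in its complement and the pairing extends to A together with the copy.
    maximal⇒U×U↣U : ∀ {M} → Pairing M → (∀ {R} → Pairing R → M ⊆ R → R ⊆ M) →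
                    (x₀ x₁ : Carrier ⟪ Field M ⟫) → x₀ ≢ x₁ → (U × U) ↣ U
    maximal⇒U×U↣U {M} good maximal x₀ x₁ x₀≢x₁ = [ outside↣inside , inside↣outside ]′ (↣-total Outside Inside)
      where
      Inside Outside : Set ℓ
      Inside  = Carrier ⟪ Field M ⟫
      Outside = Carrier ⟪ (λ x → ¬ Field M x) ⟫

      p : (Inside × Inside) ↣ Inside
      p = Pairing.pair good

      d : (Inside ⊎ Inside) ↣ Inside
      d = p ↣-∘ ⊎↣× x₀≢x₁

      split : U → Outside ⊎ Inside
      split x with em {Field M x}
      ... | yes x∈ = inj₂ (x , ∈⟪⟫⁺ x∈)
      ... | no  x∉ = inj₁ (x , ∈⟪⟫⁺ x∉)

      unsplit : Outside ⊎ Inside → U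
      unsplit = [ proj₁ , proj₁ ]′

      unsplit-split : ∀ x → unsplit (split x) ≡ x
      unsplit-split x with em {Field M x}
      ... | yes _ = refl
      ... | no  _ = refl

      U↣⊎ : U ↣ (Outside ⊎ Inside)
      U↣⊎ = mk↣ {to = split} λ {x} {y} eq →
        trans (sym (unsplit-split x)) (trans (cong unsplit eq) (unsplit-split y))

      outside↣inside : Outside ↣ Inside → (U × U) ↣ U
      outside↣inside c = Carrier-↣ _ ↣-∘ (p ↣-∘ (U↣Inside ×-↣ U↣Inside))
        where
        U↣Inside : U ↣ Inside
        U↣Inside = d ↣-∘ ((c ⊎-↣ ↣-id _) ↣-∘ U↣⊎)

      inside↣outside : Inside ↣ Outside → (U × U) ↣ U
      -- The copy of `x₀` under `c` is in the extended field, hence by maximality in the field of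
      -- `M`, yet `c` lands outside that field.
      inside↣outside c = contradiction
        (Field-mono M⁺⊆M (graph-field e doubled (inj₂ (x₀)))) (∈⟪⟫⁻ (proj₂ (to c (x₀))))
        where
        open Doubling p d
        embed : Inside ⊎ Inside → U
        embed = [ proj₁ , proj₁ ∘ to c ]′
        embed-injective : Injective _≡_ _≡_ embed
        embed-injective {inj₁ x} {inj₁ y} eq = cong inj₁ (injective (Carrier-↣ _) eq)
        embed-injective {inj₁ x} {inj₂ y} eq =
          contradiction (subst (Field M) eq (∈⟪⟫⁻ (proj₂ x))) (∈⟪⟫⁻ (proj₂ (to c y)))
        embed-injective {inj₂ x} {inj₁ y} eq =
          contradiction (subst (Field M) (sym eq) (∈⟪⟫⁻ (proj₂ y))) (∈⟪⟫⁻ (proj₂ (to c x)))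
        embed-injective {inj₂ x} {inj₂ y} eq = cong inj₂ (injective c (injective (Carrier-↣ _) eq))
        e : (Inside ⊎ Inside) ↣ U
        e = mk↣ {to = embed} embed-injective
        M⊆M⁺ : M ⊆ ⟪ Graph e doubled ⟫
        M⊆M⁺ {(x , y) , z} r with x∈ , y∈ , _ ← Pairing.closed good r =
          ∈⟪⟫⁺ (inj₁ x′ , inj₁ y′ , refl , refl , Pairing.functional good r (Pairing.pair-∈ good x′ y′))
          where
          x′ y′ : Inside
          x′ = x , ∈⟪⟫⁺ x∈
          y′ = y , ∈⟪⟫⁺ y∈
        M⁺⊆M : ⟪ Graph e doubled ⟫ ⊆ M
        M⁺⊆M = maximal (graph-pairing e doubled) M⊆M⁺

    extendPairing : {B : Set ℓ} → B ↣ U → (B × B) ↣ B → (b₀ b₁ : B) → b₀ ≢ b₁ → (U × U) ↣ U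
    extendPairing {B} e q b₀ b₁ b₀≢b₁ with Zorn.zorn Pairing ⋃-pairing (graph-pairing e q)
    ... | M , good , base⊆M , maximal =
      maximal⇒U×U↣U good maximal (point b₀) (point b₁) (b₀≢b₁ ∘ injective e ∘ cong proj₁)
      where
      point : B → Carrier ⟪ Field M ⟫
      point b = to e b , ∈⟪⟫⁺ (Field-mono base⊆M (graph-field e q b))

    U×U↣U : ℕ ↣ U → (U × U) ↣ U
    -- The copy of the naturals in `U` is the starting set; `0` and `1` become the two tags used for
    -- doubling.
    U×U↣U ι = extendPairing (ι ↣-∘ lower↣) ℕ-pair (lift 0) (lift 1) λ ()
      where
      lower↣ : Lift ℓ ℕ ↣ ℕ
      lower↣ = mk↣ {to = lower} (cong lift)
      ℕ-pair : (Lift ℓ ℕ × Lift ℓ ℕ) ↣ Lift ℓ ℕ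
      ℕ-pair = mk↣ {to = lift} (cong lower) ↣-∘ (ℕ×ℕ↣ℕ ↣-∘ (lower↣ ×-↣ lower↣))

  -- The operation and its injectivity.

  module Star {U : Set ℓ} (ι : ℕ ↣ U) (p : (U × U) ↣ U) (S : Pred U ℓ) where

    -- The first coordinate is a tag, `ι 0` here and `ι (suc n)` in `j n`, which keeps the images
    -- disjoint.
    φ : U → U
    φ u = to p (to ι 0 , u)

    φ-injective : Injective _≡_ _≡_ φ
    φ-injective eq = ,-injectiveʳ (injective p eq)

    j : ℕ → U × U → U
    j n w = to p (to ι (suc n) , to p w)

    j-injective : ∀ {m n v w} → j m v ≡ j n w → m ≡ n × v ≡ w
    j-injective eq = suc-injective (injective ι (,-injectiveˡ (injective p eq))) ,
                     injective p (,-injectiveʳ (injective p eq))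

    φ≢j : ∀ {u n w} → φ u ≢ j n w
    φ≢j eq = case injective ι (,-injectiveˡ (injective p eq)) of λ ()

    φ[S] : Pred U ℓ
    φ[S] u = ∃[ v ] S v × u ≡ φ v

    Leveled : U → Set ℓ
    Leveled u = ∃₂ λ n w → u ≡ j n w

    levelOf : ∀ {u} → Dec (Leveled u) → ℕ
    levelOf (yes (n , _)) = suc n
    levelOf (no _)        = 0

    level : U → ℕ
    level u = levelOf (em {Leveled u})

    level-j : ∀ n w → level (j n w) ≡ suc n
    level-j n w with em {Leveled (j n w)}
    -- The decision may carry other witnesses; injectivity of `j` forces their level to be `n`.
    ... | yes (_ , _ , eq) = cong suc (sym (proj₁ (j-injective eq)))
    ... | no ¬leveled      = contradiction (n , w , refl) ¬leveled

    ascend : U × U → U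
    ascend (x , y) = j (level x ⊔ level y) (x , y)

    star : ∀ w → Dec (φ[S] (proj₁ w) × proj₁ w ≡ proj₂ w) → U
    star (x , _) (yes _) = x
    star w       (no _)  = ascend w

    ⋆ : U × U → U
    ⋆ w = star w em

    data View : U × U → Set ℓ where
      loop : ∀ {x} → φ[S] x → ⋆ (x , x) ≡ x → View (x , x)
      rise : ∀ {w} → ⋆ w ≡ ascend w → View w

    view : ∀ w → View w
    view w = go em refl
      where
      go : ∀ {w} (d : Dec (φ[S] (proj₁ w) × proj₁ w ≡ proj₂ w)) → ⋆ w ≡ star w d → View w
      go (yes (x∈ , refl)) eq = loop x∈ eq
      go (no _)            eq = rise eq

    -- Loops take values in the image of `φ` and all other pairs in that of `j`, so mixed cases
    -- clash; `j` determines its argument pair.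
    ⋆-injective : Injective _≡_ _≡_ ⋆
    ⋆-injective {v} {w} eq with view v | view w
    ... | loop _ ev | loop _ ew = cong (λ x → x , x) (trans (sym ev) (trans eq ew))
    ... | loop (_ , _ , x≡) ev | rise ew = contradiction (trans (sym (trans ev x≡)) (trans eq ew)) φ≢j
    ... | rise ev | loop (_ , _ , x≡) ew = contradiction (trans (sym (trans ew x≡)) (trans (sym eq) ev)) φ≢j
    ... | rise ev | rise ew = proj₂ (j-injective (trans (sym ev) (trans eq ew)))

    ⋆-loop : ∀ {x} → φ[S] x → ⋆ (x , x) ≡ x
    ⋆-loop {x} x∈ with em {φ[S] x × x ≡ x}
    ... | yes _ = refl
    ... | no ¬x = contradiction (x∈ , refl) ¬x

    -- Fixpoints of sequences.

    sym-loop : ∀ t {u} → φ[S] u → sym⟦_⟧ ⋆ t u u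
    sym-loop π u∈ = _ , _ , sym (⋆-loop u∈) , refl , _
    sym-loop ρ u∈ = _ , _ , sym (⋆-loop u∈) , _ , refl

    φ[S]⊆fix : ∀ s {u} → φ[S] u → fix ⋆ s u
    φ[S]⊆fix (elem t)   u∈ = sym-loop t u∈
    φ[S]⊆fix (cons t s) u∈ = _ , sym-loop t u∈ , φ[S]⊆fix s u∈

    -- An invariant of runs of projections: it is transitive, and for `u = v` only its first case
    -- survives, since no level is below itself.
    Descends : U → U → Set ℓ
    Descends u v = (v ≡ u × φ[S] u) ⊎ Lift ℓ (level v < level u)

    level-ascend : ∀ {x y} → ⋆ (x , y) ≡ ascend (x , y) → level (⋆ (x , y)) ≡ suc (level x ⊔ level y)
    level-ascend eq = trans (cong level eq) (level-j _ _)

    sym-descends : ∀ t {u v} → sym⟦_⟧ ⋆ t u v → Descends u v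
    sym-descends π (x , y , refl , refl , _) with view (x , y)
    ... | loop x∈ eq = inj₁ (sym eq , subst φ[S] (sym eq) x∈)
    ... | rise eq    = inj₂ (lift (<-≤-trans (s≤s (m≤m⊔n (level x) (level y)))
                              (≤-reflexive (sym (level-ascend eq)))))
    sym-descends ρ (x , y , refl , _ , refl) with view (x , y)
    ... | loop x∈ eq = inj₁ (sym eq , subst φ[S] (sym eq) x∈)
    ... | rise eq    = inj₂ (lift (<-≤-trans (s≤s (m≤n⊔m (level x) (level y)))
                              (≤-reflexive (sym (level-ascend eq)))))

    descends-trans : ∀ {u v w} → Descends u v → Descends v w → Descends u w
    descends-trans (inj₁ (refl , _)) d                 = d
    descends-trans (inj₂ lt)         (inj₁ (refl , _)) = inj₂ lt
    descends-trans (inj₂ (lift lt))  (inj₂ (lift lt′)) = inj₂ (lift (<-≤-trans lt′ (<⇒≤ lt)))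

    descends : ∀ s {u v} → ⟦_⟧ ⋆ s u v → Descends u v
    descends (elem t)   r           = sym-descends t r
    descends (cons t s) (_ , r , q) = descends-trans (sym-descends t r) (descends s q)

    fix⊆φ[S] : ∀ s {u} → fix ⋆ s u → φ[S] u
    fix⊆φ[S] s r with descends s r
    ... | inj₁ (_ , u∈)  = u∈
    ... | inj₂ (lift lt) = contradiction lt (<-irrefl refl)

    -- The fixpoints are exactly `φ[S]`, and `φ` is injective, so taking preimages under `φ` is the
    -- bijection.
    fix≈S : ∀ s → subset (fix ⋆ s) ≈ᶜ subset S
    fix≈S s = record
      { to        = λ (_ , r) → let v , v∈ , _ = fix⊆φ[S] s r in v , v∈
      ; cong      = λ {x} {y} eq → φ-injective (trans (sym (φ-preimage x)) (trans eq (φ-preimage y)))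
      ; bijective = (λ {x} {y} eq → trans (φ-preimage x) (trans (cong φ eq) (sym (φ-preimage y))))
                  , λ (v , v∈) → (φ v , φ[S]⊆fix s (v , v∈ , refl)) ,
                      λ {z} eq → φ-injective (trans (sym (φ-preimage z)) eq)
      }
      where
      φ-preimage : ∀ ((u , r) : Σ U (fix ⋆ s)) → u ≡ φ (proj₁ (fix⊆φ[S] s r))
      φ-preimage (_ , r) = proj₂ (proj₂ (fix⊆φ[S] s r))

proposition20 : ∀ {ℓ} → ExcludedMiddle ℓ → Extensionality ℓ ℓ →
    (U : Set ℓ) → Infinite U →
    (S : Pred U ℓ) → subset S <ᶜ setoid U →
    Σ[ ⋆ ∈ (U × U → U) ]
    (Injective _≡_ _≡_ ⋆ × ((s : Sec) → subset (fix ⋆ s) ≈ᶜ subset S))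
proposition20 em ext U ι S _ = ⋆ , ⋆-injective , fix≈S
  where
  open Classical em ext
  open Star ι (U×U↣U ι) S
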